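{- Let $G$ be an $n$-vertex $d$-regular graph. Then $G$ contains a full subgraph with $\lfloor \frac{n}{2} \rfloor$ or $\lfloor \frac{n}{2} \rfloor + 1$ vertices.
   Context: Graphs are finite and simple. The density of a graph $G$ on $n \geq 2$ vertices is $p = |E(G)|/\binom{n}{2}$ (so $p = d/(n-1)$ if $G$ is $d$-regular). A full subgraph of a graph $G$ of density $p$ is an $m$-vertex subgraph $H$ of $G$ of minimum degree at least $p(m-1)$. -}

module Defs where

open import Data.Bool using (Bool; false; T)
open import Data.Bool.Properties using (T?)
open import Data.Fin using (Fin; _<?_)
open import Data.Fin.Subset using (Subset; _∈_; ∣_∣)
open import Data.Integer using (+_)
open import Data.List using (List; allFin; cartesianProduct; filter; length)
open import Data.Nat using (ℕ; suc; 2+; _+_; NonZero; NonTrivial)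
open import Data.Nat.Combinatorics using (_C_; nC1≡n; nCk+nC[k+1]≡[n+1]C[k+1])
open import Data.Product using (_×_; _,_)
open import Data.Rational using (ℚ; _/_; _≤_; _*_; _-_; 1ℚ)
open import Data.Vec using (tabulate)
open import Relation.Binary.PropositionalEquality using (_≡_; subst; sym)
open import Relation.Nullary.Decidable using (_×-dec_)

record Graph (n : ℕ) : Set where
  field
    adj        : Fin n → Fin n → Bool
    adj-sym    : ∀ u v → adj u v ≡ adj v u
    adj-irrefl : ∀ v → adj v v ≡ false

  Adj : Fin n → Fin n → Set
  Adj u v = T (adj u v)

  neighbours : Fin n → Subset n
  neighbours v = tabulate (adj v)

  degree : Fin n → ℕ
  degree v = ∣ neighbours v ∣

  -- Each edge is listed once, as the pair of its endpoints in increasing order.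
  edges : List (Fin n × Fin n)
  edges = filter (λ (u , v) → (u <? v) ×-dec T? (adj u v))
                 (cartesianProduct (allFin n) (allFin n))

open Graph public

Regular : ∀ {n} → ℕ → Graph n → Set
Regular d G = ∀ v → degree G v ≡ d

nC2-nonZero : ∀ n → .{{NonTrivial n}} → NonZero (n C 2)
nC2-nonZero (2+ k) =
  subst NonZero (nCk+nC[k+1]≡[n+1]C[k+1] (suc k) 1)
    (subst (λ x → NonZero (x + suc k C 2)) (sym (nC1≡n (suc k))) _)

ℕ→ℚ : ℕ → ℚ
ℕ→ℚ k = + k / 1

density : ∀ {n} → .{{NonTrivial n}} → Graph n → ℚ
density {n} G = (+ length (edges G) / (n C 2)) {{nC2-nonZero n}}

-- Not necessarily induced. The edge set is stored as a graph on all of Fin n,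
-- in which the vertices outside the subgraph are isolated; degrees of vertices
-- of the subgraph are therefore degrees in that graph.
record Subgraph {n} (G : Graph n) : Set where
  field
    vertices   : Subset n
    graph      : Graph n
    adj⇒adj    : ∀ {u v} → Adj graph u v → Adj G u v
    adj⇒vertex : ∀ {u v} → Adj graph u v → u ∈ vertices

  order : ℕ
  order = ∣ vertices ∣

  MinDegree≥ : ℚ → Set
  MinDegree≥ q = ∀ {v} → v ∈ vertices → q ≤ ℕ→ℚ (degree graph v)

open Subgraph public

Full : ∀ {n} → .{{NonTrivial n}} → {G : Graph n} → Subgraph G → Set
Full {G = G} H = MinDegree≥ H (density G * (ℕ→ℚ (order H) - 1ℚ))

{-# OPTIONS --safe #-}
-- Among the vertex sets of size ⌊n/2⌋, let A span the most edges. If no vertex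
-- outside A has more than d/2 neighbours in A, then every vertex of ∁ A has at
-- least d/2 neighbours in ∁ A, and ∁ A is full. Otherwise some b ∉ A has more
-- than d/2 neighbours in A. Exchanging a ∈ A for b gains no edges, so in A ∪ {b}
-- the degree of a is at least the number of neighbours of b in A; hence all
-- degrees in A ∪ {b} exceed d/2, and A ∪ {b} is full.
module Submission where

open import Defs
open import Data.Bool using (Bool; true; false; not; _∧_)
open import Data.Bool.Properties using (T-≡; T-∧; T?; not-involutive) renaming (_≟_ to _≟ᵇ_)
open import Data.Fin as Fin using (Fin; zero; suc)
open import Data.Fin.Properties using (any?) renaming (<-cmp to <-cmpᶠ)
open import Data.Fin.Subset using (Subset; ∣_∣; ∁; ⊥)
open import Data.Fin.Subset.Properties using (∣p∣≤n; ∣⊥∣≡0; ∣∁p∣≡n∸∣p∣)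
import Data.Integer as ℤ
import Data.Integer.Properties as ℤ
open import Data.List as List using (_++_; cartesianProduct; filter; length)
open import Data.List.Properties using (filter-++; length-++)
open import Data.Nat
open import Data.Nat.Combinatorics using (_C_; nC1≡n; nCk+nC[k+1]≡[n+1]C[k+1])
open import Data.Nat.Properties
open import Data.Nat.Tactic.RingSolver using (solve-∀)
open import Data.Product using (_×_; ∃-syntax; _,_; proj₁; proj₂)
import Data.Rational as ℚ
open import Data.Rational using (1ℚ)
import Data.Rational.Properties as ℚ
import Data.Rational.Unnormalised as ℚᵘ
import Data.Rational.Unnormalised.Properties as ℚᵘ
open import Data.Sum as Sum using (_⊎_; inj₁; inj₂)
open import Data.Vec using ([]; _∷_; lookup; tabulate; _[_]≔_)
open import Data.Vec.Properties
  using (lookup⇒[]=; []=⇒lookup; lookup-map; lookup∘update; lookup∘update′; []≔-idempotent; []≔-lookup)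
open import Function using (_∘_; id)
open import Function.Bundles using (Equivalence)
open import Relation.Binary.Definitions using (tri<; tri≈; tri>)
open import Relation.Binary.PropositionalEquality
open import Relation.Nullary using (¬_; yes; no; does; contradiction)
open import Relation.Nullary.Decidable using (_×-dec_; dec-true; dec-false)
open import Relation.Unary using (Pred; Decidable)
open import Algebra.Properties.CommutativeSemigroup *-commutativeSemigroup using (x∙yz≈y∙xz)
open import Algebra.Properties.Semiring.Sum +-*-semiring
  using (sum; sum-cong-≗; ∑-distrib-+; ∑-comm)

-- Counting by sums of indicators.

⟦_⟧ : Bool → ℕ
⟦ true  ⟧ = 1
⟦ false ⟧ = 0

⟦∧⟧ : ∀ x y → ⟦ x ∧ y ⟧ ≡ ⟦ x ⟧ * ⟦ y ⟧
⟦∧⟧ true  y = sym (+-identityʳ ⟦ y ⟧)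
⟦∧⟧ false y = refl

sum-const : ∀ n c → sum {n} (λ _ → c) ≡ n * c
sum-const zero    c = refl
sum-const (suc n) c = cong (c +_) (sum-const n c)

∣tabulate∣ : ∀ {n} (f : Fin n → Bool) → ∣ tabulate f ∣ ≡ sum (λ i → ⟦ f i ⟧)
∣tabulate∣ {zero}  f = refl
∣tabulate∣ {suc n} f with f zero
... | true  = cong suc (∣tabulate∣ (f ∘ suc))
... | false = ∣tabulate∣ (f ∘ suc)

-- `allFin` is a tabulation, and its tail is no longer of the form `allFin`; an arbitrary `f` lets
-- the induction pass to `f ∘ suc`. The map `g` is there because each row of a cartesian product is
-- a mapped list.
length-filter-map : ∀ {a b p} {A : Set a} {B : Set b} {P : Pred B p} (P? : Decidable P)
  {n} (f : Fin n → A) (g : A → B) →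
  length (filter P? (List.map g (List.tabulate f))) ≡ sum (λ i → ⟦ does (P? (g (f i))) ⟧)
length-filter-map P? {zero}  f g = refl
length-filter-map P? {suc n} f g with does (P? (g (f zero)))
... | true  = cong suc (length-filter-map P? (f ∘ suc) g)
... | false = length-filter-map P? (f ∘ suc) g

length-filter-cartesianProduct : ∀ {a b p} {A : Set a} {B : Set b} {P : Pred (A × B) p}
  (P? : Decidable P) {m n} (f : Fin m → A) (g : Fin n → B) →
  length (filter P? (cartesianProduct (List.tabulate f) (List.tabulate g)))
    ≡ sum (λ i → sum (λ j → ⟦ does (P? (f i , g j)) ⟧))
length-filter-cartesianProduct P? {zero}  f g = refl
length-filter-cartesianProduct P? {suc m} f g = begin
  length (filter P? (row ++ rest))                    ≡⟨ cong length (filter-++ P? row rest) ⟩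
  length (filter P? row ++ filter P? rest)            ≡⟨ length-++ (filter P? row) ⟩
  length (filter P? row) + length (filter P? rest)
    ≡⟨ cong₂ _+_ (length-filter-map P? g (f zero ,_)) (length-filter-cartesianProduct P? (f ∘ suc) g) ⟩
  sum (λ i → sum (λ j → ⟦ does (P? (f i , g j)) ⟧))   ∎
  where
  open ≡-Reasoning
  row  = List.map (f zero ,_) (List.tabulate g)
  rest = cartesianProduct (List.tabulate (f ∘ suc)) (List.tabulate g)

-- Clearing denominators in the density bound.

2*nC2 : ∀ n → 2 * (suc n C 2) ≡ suc n * n
2*nC2 zero    = refl
2*nC2 (suc n) = begin
  2 * (suc (suc n) C 2)             ≡⟨ cong (2 *_) (nCk+nC[k+1]≡[n+1]C[k+1] (suc n) 1) ⟨
  2 * (suc n C 1 + suc n C 2)       ≡⟨ *-distribˡ-+ 2 (suc n C 1) (suc n C 2) ⟩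
  2 * (suc n C 1) + 2 * (suc n C 2) ≡⟨ cong₂ (λ x y → 2 * x + y) (nC1≡n (suc n)) (2*nC2 n) ⟩
  2 * suc n + suc n * n             ≡⟨ arith n ⟩
  suc (suc n) * suc n               ∎
  where
  open ≡-Reasoning
  arith : ∀ n → 2 * suc n + suc n * n ≡ suc (suc n) * suc n
  arith = solve-∀

-- Normalised rationals hide numerators behind gcd reduction, so both sides are moved to
-- unnormalised rationals, where the comparison is plain cross-multiplication. Writing the order as
-- `suc k` turns the subtraction of one into `k` and avoids truncated subtraction.
/-*-pred-≤ : ∀ e c .{{_ : NonZero c}} k D → e * k ≤ D * c →
  (ℤ.+ e ℚ./ c) ℚ.* (ℕ→ℚ (suc k) ℚ.- 1ℚ) ℚ.≤ ℕ→ℚ D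
/-*-pred-≤ e c@(suc c-1) k D ek≤Dc = ℚ.toℚᵘ-cancel-≤ (begin
  ℚ.toℚᵘ (p ℚ.* (q ℚ.- 1ℚ))                 ≃⟨ ℚ.toℚᵘ-homo-* p (q ℚ.- 1ℚ) ⟩
  ℚ.toℚᵘ p ℚᵘ.* ℚ.toℚᵘ (q ℚ.- 1ℚ)
    ≃⟨ ℚᵘ.*-cong (ℚ.toℚᵘ-fromℚᵘ pᵘ)
         (ℚᵘ.≃-trans (ℚ.toℚᵘ-homo-+ q (ℚ.- 1ℚ)) (ℚᵘ.+-congˡ (ℚ.toℚᵘ (ℚ.- 1ℚ)) (ℚ.toℚᵘ-fromℚᵘ qᵘ))) ⟩
  pᵘ ℚᵘ.* (qᵘ ℚᵘ.- ℚᵘ.1ℚᵘ)                  ≤⟨ ℚᵘ.*≤* ineq ⟩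
  Dᵘ                                        ≃⟨ ℚ.toℚᵘ-fromℚᵘ Dᵘ ⟨
  ℚ.toℚᵘ (ℕ→ℚ D)                            ∎)
  where
  open ℚᵘ.≤-Reasoning
  p = ℤ.+ e ℚ./ c
  q = ℕ→ℚ (suc k)
  pᵘ = ℚᵘ.mkℚᵘ (ℤ.+ e) c-1
  qᵘ = ℚᵘ.mkℚᵘ (ℤ.+ suc k) 0
  Dᵘ = ℚᵘ.mkℚᵘ (ℤ.+ D) 0
  lhs≡ : ℚᵘ.↥ (pᵘ ℚᵘ.* (qᵘ ℚᵘ.- ℚᵘ.1ℚᵘ)) ℤ.* (ℤ.+ 1) ≡ ℤ.+ (e * k)
  lhs≡ = trans (ℤ.*-identityʳ _)
    (trans (cong (λ x → (ℤ.+ e) ℤ.* (ℤ.+ x)) (*-identityʳ k)) (sym (ℤ.pos-* e k)))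
  rhs≡ : (ℤ.+ D) ℤ.* ℚᵘ.↧ (pᵘ ℚᵘ.* (qᵘ ℚᵘ.- ℚᵘ.1ℚᵘ)) ≡ ℤ.+ (D * c)
  rhs≡ = trans (sym (ℤ.pos-* D (c * 1))) (cong (λ x → ℤ.+ (D * x)) (*-identityʳ c))
  ineq : ℚᵘ.↥ (pᵘ ℚᵘ.* (qᵘ ℚᵘ.- ℚᵘ.1ℚᵘ)) ℤ.* (ℤ.+ 1) ℤ.≤ (ℤ.+ D) ℤ.* ℚᵘ.↧ (pᵘ ℚᵘ.* (qᵘ ℚᵘ.- ℚᵘ.1ℚᵘ))
  ineq = subst₂ ℤ._≤_ (sym lhs≡) (sym rhs≡) (ℤ.+≤+ ek≤Dc)

-- Exhaustive search over subsets, and their sizes.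

argmax : ∀ {n p} {P : Pred (Subset n) p} (P? : Decidable P) (f : Subset n → ℕ) →
  (∀ s → ¬ P s) ⊎ (∃[ s ] P s × (∀ t → P t → f t ≤ f s))
argmax {zero} P? f with P? []
... | yes p[] = inj₂ ([] , p[] , λ { [] _ → ≤-refl })
... | no ¬p[] = inj₁ λ { [] → ¬p[] }
-- The search splits on membership of the first element. Either half may contain no candidate, hence
-- the first alternative in the result; if both do, their two maximisers are compared.
argmax {suc n} P? f
  with argmax (P? ∘ (true ∷_)) (f ∘ (true ∷_)) | argmax (P? ∘ (false ∷_)) (f ∘ (false ∷_))
... | inj₁ none | inj₁ none′ = inj₁ λ { (true ∷ s) → none s ; (false ∷ s) → none′ s }
... | inj₁ none | inj₂ (s , ps , max) =
  inj₂ (_ , ps , λ { (true ∷ t) pt → contradiction pt (none t) ; (false ∷ t) → max t })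
... | inj₂ (s , ps , max) | inj₁ none =
  inj₂ (_ , ps , λ { (true ∷ t) → max t ; (false ∷ t) pt → contradiction pt (none t) })
... | inj₂ (s , ps , max) | inj₂ (s′ , ps′ , max′) with ≤-total (f (true ∷ s)) (f (false ∷ s′))
...   | inj₁ le = inj₂ (_ , ps′ , λ { (true ∷ t) pt → ≤-trans (max t pt) le ; (false ∷ t) → max′ t })
...   | inj₂ ge = inj₂ (_ , ps , λ { (true ∷ t) → max t ; (false ∷ t) pt → ≤-trans (max′ t pt) ge })

subset-of-size : ∀ {n h} → h ≤ n → ∃[ s ] ∣_∣ {n} s ≡ h
subset-of-size {n} z≤n   = ⊥ , ∣⊥∣≡0 n
subset-of-size (s≤s h≤n) with subset-of-size h≤n
... | s , ∣s∣≡h = true ∷ s , cong suc ∣s∣≡h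

∣insert∣ : ∀ {n} (s : Subset n) v → lookup s v ≡ false → ∣ s [ v ]≔ true ∣ ≡ suc ∣ s ∣
∣insert∣ (false ∷ s) zero    _   = refl
∣insert∣ (true  ∷ s) (suc v) v∉s = cong suc (∣insert∣ s v v∉s)
∣insert∣ (false ∷ s) (suc v) v∉s = ∣insert∣ s v v∉s

insert-remove : ∀ {n} (s : Subset n) v → lookup s v ≡ true → s [ v ]≔ false [ v ]≔ true ≡ s
insert-remove s v v∈s = begin
  s [ v ]≔ false [ v ]≔ true ≡⟨ []≔-idempotent s v ⟩
  s [ v ]≔ true              ≡⟨ cong (s [ v ]≔_) v∈s ⟨
  s [ v ]≔ lookup s v        ≡⟨ []≔-lookup s v ⟩
  s                          ∎
  where open ≡-Reasoning

-- Sums over a subset, as weighted sums over all of `Fin n`.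

∑∈ : ∀ {n} → Subset n → (Fin n → ℕ) → ℕ
∑∈ s f = sum (λ u → ⟦ lookup s u ⟧ * f u)

∑∈-cong : ∀ {n} (s : Subset n) {f g : Fin n → ℕ} → f ≗ g → ∑∈ s f ≡ ∑∈ s g
∑∈-cong s f≗g = sum-cong-≗ (λ u → cong (⟦ lookup s u ⟧ *_) (f≗g u))

∑∈-distrib-+ : ∀ {n} (s : Subset n) (f g : Fin n → ℕ) →
  ∑∈ s (λ u → f u + g u) ≡ ∑∈ s f + ∑∈ s g
∑∈-distrib-+ s f g = trans
  (sum-cong-≗ (λ u → *-distribˡ-+ ⟦ lookup s u ⟧ (f u) (g u)))
  (∑-distrib-+ (λ u → ⟦ lookup s u ⟧ * f u) (λ u → ⟦ lookup s u ⟧ * g u))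

∑∈-insert : ∀ {n} (s : Subset n) v → lookup s v ≡ false → ∀ f →
  ∑∈ (s [ v ]≔ true) f ≡ ∑∈ s f + f v
∑∈-insert (false ∷ s) zero    _   f =
  trans (cong (_+ ∑∈ s (f ∘ suc)) (*-identityˡ (f zero))) (+-comm (f zero) _)
∑∈-insert (x ∷ s)     (suc v) v∉s f =
  trans (cong (_ +_) (∑∈-insert s v v∉s (f ∘ suc))) (sym (+-assoc (⟦ x ⟧ * f zero) _ _))

∑∈-∁ : ∀ {n} (s : Subset n) f → ∑∈ s f + ∑∈ (∁ s) f ≡ sum f
∑∈-∁ s f = trans
  (sym (∑-distrib-+ (λ u → ⟦ lookup s u ⟧ * f u) (λ u → ⟦ lookup (∁ s) u ⟧ * f u)))
  (sum-cong-≗ pointwise)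
  where
  pointwise : ∀ u → ⟦ lookup s u ⟧ * f u + ⟦ lookup (∁ s) u ⟧ * f u ≡ f u
  pointwise u rewrite lookup-map u not s with lookup s u
  ... | true  = trans (+-identityʳ _) (*-identityˡ (f u))
  ... | false = *-identityˡ (f u)

-- Edge counts and degrees into a vertex set.

module _ {n} (G : Graph n) where

  adjℕ : Fin n → Fin n → ℕ
  adjℕ u v = ⟦ adj G u v ⟧

  adjℕ-sym : ∀ u v → adjℕ u v ≡ adjℕ v u
  adjℕ-sym u v = cong ⟦_⟧ (adj-sym G u v)

  adjℕ-irrefl : ∀ v → adjℕ v v ≡ 0
  adjℕ-irrefl v = cong ⟦_⟧ (adj-irrefl G v)

  -- This is the handshake count. The listed edges form the strictly upper triangle `up` of the
  -- adjacency matrix. One of the two copies is transposed by exchanging the sums, and a triangle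
  -- plus its transpose is the whole matrix, because the diagonal is zero; each row then sums to
  -- `d`.
  2*∣edges∣ : ∀ {d} → Regular d G → 2 * length (edges G) ≡ n * d
  2*∣edges∣ {d} regular = begin
    2 * length (edges G)
      ≡⟨ cong (2 *_) (length-filter-cartesianProduct (λ (u , v) → (u Fin.<? v) ×-dec T? (adj G u v)) id id) ⟩
    2 * sum (λ u → sum (up u))
      ≡⟨ cong (sum (λ u → sum (up u)) +_) (+-identityʳ _) ⟩
    sum (λ u → sum (up u)) + sum (λ u → sum (up u))
      ≡⟨ cong (sum (λ u → sum (up u)) +_) (∑-comm up) ⟩
    sum (λ u → sum (up u)) + sum (λ u → sum (λ v → up v u))
      ≡⟨ ∑-distrib-+ (λ u → sum (up u)) (λ u → sum (λ v → up v u)) ⟨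
    sum (λ u → sum (up u) + sum (λ v → up v u))
      ≡⟨ sum-cong-≗ (λ u → sym (∑-distrib-+ (up u) (λ v → up v u))) ⟩
    sum (λ u → sum (λ v → up u v + up v u))
      ≡⟨ sum-cong-≗ (λ u → sum-cong-≗ (up+up u)) ⟩
    sum (λ u → sum (adjℕ u))
      ≡⟨ sum-cong-≗ (λ u → trans (sym (∣tabulate∣ (adj G u))) (regular u)) ⟩
    sum {n} (λ _ → d)
      ≡⟨ sum-const n d ⟩
    n * d ∎
    where
    open ≡-Reasoning
    up : Fin n → Fin n → ℕ
    up u v = ⟦ does (u Fin.<? v) ∧ adj G u v ⟧
    up+up : ∀ u v → up u v + up v u ≡ adjℕ u v
    up+up u v with <-cmpᶠ u v
    ... | tri< u<v _ v≮u
      rewrite dec-true (u Fin.<? v) u<v | dec-false (v Fin.<? u) v≮u = +-identityʳ _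
    ... | tri> u≮v _ v<u
      rewrite dec-false (u Fin.<? v) u≮v | dec-true (v Fin.<? u) v<u = adjℕ-sym v u
    ... | tri≈ u≮u refl _
      rewrite dec-false (u Fin.<? u) u≮u = sym (adjℕ-irrefl u)

  degIn : Subset n → Fin n → ℕ
  degIn s v = ∑∈ s (adjℕ v)

  degIn-insert : ∀ s b → lookup s b ≡ false → ∀ v →
    degIn (s [ b ]≔ true) v ≡ degIn s v + adjℕ v b
  degIn-insert s b b∉s v = ∑∈-insert s b b∉s (adjℕ v)

  degIn-∁ : ∀ s v → degIn s v + degIn (∁ s) v ≡ degree G v
  degIn-∁ s v = trans (∑∈-∁ s (adjℕ v)) (sym (∣tabulate∣ (adj G v)))

  -- Twice the number of edges spanned by s.
  edgeWeight : Subset n → ℕ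
  edgeWeight s = ∑∈ s (degIn s)

  -- The new vertex contributes its degree into `s` twice: once as a new summand, and once spread
  -- over the old summands, where symmetry of adjacency collects it.
  edgeWeight-insert : ∀ s v → lookup s v ≡ false →
    edgeWeight (s [ v ]≔ true) ≡ edgeWeight s + 2 * degIn s v
  edgeWeight-insert s v v∉s = begin
    edgeWeight (s [ v ]≔ true)
      ≡⟨ ∑∈-cong (s [ v ]≔ true) (degIn-insert s v v∉s) ⟩
    ∑∈ (s [ v ]≔ true) (λ u → degIn s u + adjℕ u v)
      ≡⟨ ∑∈-insert s v v∉s (λ u → degIn s u + adjℕ u v) ⟩
    ∑∈ s (λ u → degIn s u + adjℕ u v) + (degIn s v + adjℕ v v)
      ≡⟨ cong₂ _+_ (∑∈-distrib-+ s (degIn s) (λ u → adjℕ u v)) (cong (degIn s v +_) (adjℕ-irrefl v)) ⟩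
    edgeWeight s + ∑∈ s (λ u → adjℕ u v) + (degIn s v + 0)
      ≡⟨ cong (λ x → edgeWeight s + x + (degIn s v + 0)) (∑∈-cong s (λ u → adjℕ-sym u v)) ⟩
    edgeWeight s + degIn s v + (degIn s v + 0)
      -- The `0` left by the absent loop at `v` is the one in the unfolding of `2 * degIn s v`.
      ≡⟨ +-assoc (edgeWeight s) _ _ ⟩
    edgeWeight s + 2 * degIn s v ∎
    where open ≡-Reasoning

  -- Remove `a` from `A`. Putting back `a` recovers `A`, while putting in `b` gives a competitor of
  -- the same size, so by maximality `b` has at most as many neighbours as `a` in the remainder. The
  -- possible edge between `a` and `b` then adds the same amount to both sides.
  degIn-exchange : ∀ A → (∀ B → ∣ B ∣ ≡ ∣ A ∣ → edgeWeight B ≤ edgeWeight A) →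
    ∀ a b → lookup A a ≡ true → lookup A b ≡ false →
    degIn A b ≤ degIn (A [ b ]≔ true) a
  degIn-exchange A max a b a∈A b∉A = begin
    degIn A b                  ≡⟨ degIn-A b ⟩
    degIn A∖a b + adjℕ b a       ≤⟨ +-monoˡ-≤ (adjℕ b a) degIn-b≤degIn-a ⟩
    degIn A∖a a + adjℕ b a       ≡⟨ cong₂ _+_ (sym degIn-a) (adjℕ-sym b a) ⟩
    degIn A a + adjℕ a b       ≡⟨ degIn-insert A b b∉A a ⟨
    degIn (A [ b ]≔ true) a    ∎
    where
    open ≤-Reasoning
    A∖a = A [ a ]≔ false
    reinsert : A∖a [ a ]≔ true ≡ A
    reinsert = insert-remove A a a∈A
    a∉A∖a : lookup A∖a a ≡ false
    a∉A∖a = lookup∘update a A false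
    b≢a : b ≢ a
    b≢a refl = contradiction (trans (sym a∈A) b∉A) λ()
    b∉A∖a : lookup A∖a b ≡ false
    b∉A∖a = trans (lookup∘update′ b≢a A false) b∉A
    degIn-A : ∀ v → degIn A v ≡ degIn A∖a v + adjℕ v a
    degIn-A v = trans (cong (λ s → degIn s v) (sym reinsert)) (degIn-insert A∖a a a∉A∖a v)
    degIn-a : degIn A a ≡ degIn A∖a a
    degIn-a = trans (degIn-A a) (trans (cong (degIn A∖a a +_) (adjℕ-irrefl a)) (+-identityʳ _))
    size : ∣ A∖a [ b ]≔ true ∣ ≡ ∣ A ∣
    size = trans (∣insert∣ A∖a b b∉A∖a) (trans (sym (∣insert∣ A∖a a a∉A∖a)) (cong ∣_∣ reinsert))
    degIn-b≤degIn-a : degIn A∖a b ≤ degIn A∖a a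
    degIn-b≤degIn-a = *-cancelˡ-≤ 2 (+-cancelˡ-≤ (edgeWeight A∖a) _ _ (begin
      edgeWeight A∖a + 2 * degIn A∖a b ≡⟨ edgeWeight-insert A∖a b b∉A∖a ⟨
      edgeWeight (A∖a [ b ]≔ true)   ≤⟨ max (A∖a [ b ]≔ true) size ⟩
      edgeWeight A                 ≡⟨ cong edgeWeight reinsert ⟨
      edgeWeight (A∖a [ a ]≔ true)   ≡⟨ edgeWeight-insert A∖a a a∉A∖a ⟩
      edgeWeight A∖a + 2 * degIn A∖a a ∎))

  -- Induced subgraphs and a criterion for fullness.

  induced : Subset n → Subgraph G
  induced s = record
    { vertices   = s
    ; graph      = record
      -- Testing both endpoints isolates every vertex outside `s`, so degrees in this graph on all
      -- of `Fin n` count neighbours in `s` only.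
      { adj        = λ u v → lookup s u ∧ (lookup s v ∧ adj G u v)
      ; adj-sym    = λ u v → induced-sym (lookup s u) (lookup s v) (adj-sym G u v)
      ; adj-irrefl = λ v → induced-irrefl (lookup s v) (adj-irrefl G v)
      }
    ; adj⇒adj    = λ {u} {v} e →
        proj₂ (Equivalence.to (T-∧ {lookup s v}) (proj₂ (Equivalence.to (T-∧ {lookup s u}) e)))
    ; adj⇒vertex = λ {u} {v} e →
        lookup⇒[]= u s (Equivalence.to T-≡ (proj₁ (Equivalence.to (T-∧ {lookup s u}) e)))
    }
    where
    induced-sym : ∀ x y {p q} → p ≡ q → x ∧ (y ∧ p) ≡ y ∧ (x ∧ q)
    induced-sym true  true  p≡q = p≡q
    induced-sym true  false _   = refl
    induced-sym false true  _   = refl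
    induced-sym false false _   = refl
    induced-irrefl : ∀ x {p} → p ≡ false → x ∧ (x ∧ p) ≡ false
    induced-irrefl true  p≡false = p≡false
    induced-irrefl false _       = refl

  degree-induced : ∀ s v → lookup s v ≡ true → degree (graph (induced s)) v ≡ degIn s v
  degree-induced s v v∈s = trans (∣tabulate∣ (adj (graph (induced s)) v)) (sum-cong-≗ pointwise)
    where
    pointwise : ∀ u → ⟦ lookup s v ∧ (lookup s u ∧ adj G v u) ⟧ ≡ ⟦ lookup s u ⟧ * adjℕ v u
    pointwise u rewrite v∈s = ⟦∧⟧ (lookup s u) (adj G v u)

-- A vertex is not its own neighbour, which leaves `m` candidates. One vertex suffices, since
-- regularity turns this into a bound on the common degree.
degree≤ : ∀ {m} (G : Graph (suc m)) → degree G zero ≤ m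
degree≤ G rewrite adj-irrefl G zero = ∣p∣≤n (tabulate (adj G zero ∘ suc))

-- With n = `2+ m`, the density is d/(n-1), so the degree hypothesis is fullness with denominators
-- cleared. To compare with the definition of density, it is multiplied by n: twice the edge count
-- is nd, and twice the binomial coefficient is n(n-1).
induced-full : ∀ {m d} (G : Graph (2+ m)) → Regular d G → ∀ s k → ∣ s ∣ ≡ suc k →
  (∀ v → lookup s v ≡ true → d * k ≤ degIn G s v * suc m) → Full (induced G s)
induced-full {m} {d} G regular s k size deg≥ {v} v∈s =
  subst₂ (λ x y → density G ℚ.* (ℕ→ℚ x ℚ.- 1ℚ) ℚ.≤ ℕ→ℚ y)
    (sym size) (sym (degree-induced G s v ([]=⇒lookup v∈s)))
    (/-*-pred-≤ ∣E∣ (2+ m C 2) {{nC2-nonZero (2+ m)}} k D edges-bound)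
  where
  open ≤-Reasoning
  ∣E∣ = length (edges G)
  D = degIn G s v
  edges-bound : ∣E∣ * k ≤ D * (2+ m C 2)
  edges-bound = *-cancelˡ-≤ 2 (begin
    2 * (∣E∣ * k)          ≡⟨ *-assoc 2 ∣E∣ k ⟨
    2 * ∣E∣ * k            ≡⟨ cong (_* k) (2*∣edges∣ G regular) ⟩
    2+ m * d * k           ≡⟨ *-assoc (2+ m) d k ⟩
    2+ m * (d * k)         ≤⟨ *-monoʳ-≤ (2+ m) (deg≥ v ([]=⇒lookup v∈s)) ⟩
    2+ m * (D * suc m)     ≡⟨ x∙yz≈y∙xz (2+ m) D (suc m) ⟩
    D * (2+ m * suc m)     ≡⟨ cong (D *_) (2*nC2 (suc m)) ⟨
    D * (2 * (2+ m C 2))   ≡⟨ x∙yz≈y∙xz D 2 (2+ m C 2) ⟩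
    2 * (D * (2+ m C 2))   ∎)

-- Arithmetic of halves.

⌈n/2⌉≡⌊n/2⌋⊎1+⌊n/2⌋ : ∀ n → ⌈ n /2⌉ ≡ ⌊ n /2⌋ ⊎ ⌈ n /2⌉ ≡ suc ⌊ n /2⌋
⌈n/2⌉≡⌊n/2⌋⊎1+⌊n/2⌋ zero          = inj₁ refl
⌈n/2⌉≡⌊n/2⌋⊎1+⌊n/2⌋ (suc zero)    = inj₂ refl
⌈n/2⌉≡⌊n/2⌋⊎1+⌊n/2⌋ (suc (suc n)) = Sum.map (cong suc) (cong suc) (⌈n/2⌉≡⌊n/2⌋⊎1+⌊n/2⌋ n)

n∸⌊n/2⌋≡⌈n/2⌉ : ∀ n → n ∸ ⌊ n /2⌋ ≡ ⌈ n /2⌉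
n∸⌊n/2⌋≡⌈n/2⌉ n = trans
  (cong (_∸ ⌊ n /2⌋) (sym (⌊n/2⌋+⌈n/2⌉≡n n)))
  (m+n∸m≡n ⌊ n /2⌋ ⌈ n /2⌉)

2*⌊n/2⌋≤n : ∀ n → 2 * ⌊ n /2⌋ ≤ n
2*⌊n/2⌋≤n zero          = z≤n
2*⌊n/2⌋≤n (suc zero)    = z≤n
2*⌊n/2⌋≤n (suc (suc n)) = ≤-trans (≤-reflexive (*-suc 2 ⌊ n /2⌋)) (s≤s (s≤s (2*⌊n/2⌋≤n n)))

complement-arith : ∀ {d D k N} → d ≤ 2 * D → 2 * k ≤ N → d * k ≤ D * N
complement-arith {d} {D} {k} {N} d≤2D 2k≤N = begin
  d * k       ≤⟨ *-monoˡ-≤ k d≤2D ⟩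
  2 * D * k   ≡⟨ swap D k ⟩
  D * (2 * k) ≤⟨ *-monoʳ-≤ D 2k≤N ⟩
  D * N       ∎
  where
  open ≤-Reasoning
  swap : ∀ D k → 2 * D * k ≡ D * (2 * k)
  swap = solve-∀

-- Here `2 * h` may exceed `N` by one, at a cost of `d` after doubling. Since `d` is at most `N`,
-- the strict inequality `d < 2 * D` pays for it.
insert-arith : ∀ {d D h N} → d < 2 * D → d ≤ N → 2 * h ≤ suc N → d * h ≤ D * N
insert-arith {d} {D} {h} {N} d<2D d≤N 2h≤1+N = *-cancelˡ-≤ 2 (begin
  2 * (d * h) ≡⟨ x∙yz≈y∙xz 2 d h ⟩
  d * (2 * h) ≤⟨ *-monoʳ-≤ d 2h≤1+N ⟩
  d * suc N   ≡⟨ *-suc d N ⟩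
  d + d * N   ≤⟨ +-monoˡ-≤ (d * N) d≤N ⟩
  suc d * N   ≤⟨ *-monoˡ-≤ N d<2D ⟩
  2 * D * N   ≡⟨ *-assoc 2 D N ⟩
  2 * (D * N) ∎)
  where open ≤-Reasoning

-- The extremal subset and the theorem.

half-subset : ∀ {m d} (G : Graph (2+ m)) → Regular d G →
  ∃[ s ] ∃[ k ] ∣ s ∣ ≡ suc k × (∀ v → lookup s v ≡ true → d * k ≤ degIn G s v * suc m) ×
    (∣ s ∣ ≡ ⌊ 2+ m /2⌋ ⊎ ∣ s ∣ ≡ suc ⌊ 2+ m /2⌋)
half-subset {m} {d} G regular with argmax (λ s → ∣ s ∣ ≟ ⌊ 2+ m /2⌋) (edgeWeight G)
... | inj₁ none =
  let s , ∣s∣≡h = subset-of-size (⌊n/2⌋≤n (2+ m)) in contradiction ∣s∣≡h (none s)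
... | inj₂ (A , ∣A∣≡h , max)
  with any? (λ b → (lookup A b ≟ᵇ false) ×-dec (d <? 2 * degIn G A b))
...   | yes (b , b∉A , d<2deg) =
  A∪b , h , size , deg≥ , inj₂ size
  where
  h = ⌊ 2+ m /2⌋
  A∪b = A [ b ]≔ true
  size : ∣ A∪b ∣ ≡ suc h
  size = trans (∣insert∣ A b b∉A) (cong suc ∣A∣≡h)
  degIn-A∪b≥ : ∀ v → lookup A∪b v ≡ true → degIn G A b ≤ degIn G A∪b v
  degIn-A∪b≥ v v∈A∪b with v Fin.≟ b
  -- The added vertex keeps its neighbours in `A`; any other member lies in `A`, where the exchange
  -- bound applies.
  ... | yes refl = ≤-trans (m≤m+n _ _) (≤-reflexive (sym (degIn-insert G A b b∉A b)))
  ... | no v≢b   = degIn-exchange G A (λ B ∣B∣ → max B (trans ∣B∣ ∣A∣≡h)) v b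
                     (trans (sym (lookup∘update′ v≢b A true)) v∈A∪b) b∉A
  deg≥ : ∀ v → lookup A∪b v ≡ true → d * h ≤ degIn G A∪b v * suc m
  deg≥ v v∈A∪b = insert-arith {D = degIn G A∪b v}
    (<-≤-trans d<2deg (*-monoʳ-≤ 2 (degIn-A∪b≥ v v∈A∪b)))
    (subst (_≤ suc m) (regular zero) (degree≤ G))
    (2*⌊n/2⌋≤n (2+ m))
...   | no ¬b =
  -- `⌈ 2+ m /2⌉` reduces to `suc ⌈ m /2⌉`, so the order less one is `⌈ m /2⌉`.
  ∁ A , ⌈ m /2⌉ , size , deg≥ ,
  subst (λ x → x ≡ ⌊ 2+ m /2⌋ ⊎ x ≡ suc ⌊ 2+ m /2⌋) (sym size) (⌈n/2⌉≡⌊n/2⌋⊎1+⌊n/2⌋ (2+ m))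
  where
  size : ∣ ∁ A ∣ ≡ ⌈ 2+ m /2⌉
  size = trans (∣∁p∣≡n∸∣p∣ A) (trans (cong (2+ m ∸_) ∣A∣≡h) (n∸⌊n/2⌋≡⌈n/2⌉ (2+ m)))
  d≤2deg : ∀ v → lookup A v ≡ false → d ≤ 2 * degIn G (∁ A) v
  d≤2deg v v∉A = +-cancelˡ-≤ (2 * degIn G A v) _ _ (begin
    2 * degIn G A v + d                       ≤⟨ +-monoˡ-≤ d (≮⇒≥ (λ d<2deg → ¬b (v , v∉A , d<2deg))) ⟩
    d + d                                     ≡⟨ cong (d +_) (+-identityʳ d) ⟨
    2 * d                                     ≡⟨ cong (2 *_) (trans (degIn-∁ G A v) (regular v)) ⟨
    2 * (degIn G A v + degIn G (∁ A) v)       ≡⟨ *-distribˡ-+ 2 (degIn G A v) _ ⟩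
    2 * degIn G A v + 2 * degIn G (∁ A) v     ∎)
    where open ≤-Reasoning
  ∈∁⇒∉ : ∀ v → lookup (∁ A) v ≡ true → lookup A v ≡ false
  ∈∁⇒∉ v v∈∁A = trans (sym (not-involutive (lookup A v)))
    (cong not (trans (sym (lookup-map v not A)) v∈∁A))
  deg≥ : ∀ v → lookup (∁ A) v ≡ true → d * ⌈ m /2⌉ ≤ degIn G (∁ A) v * suc m
  -- By definition `⌈ m /2⌉` is `⌊ suc m /2⌋`, so its double is at most n-1, and the non-strict
  -- bound `d ≤ 2 * D` is enough.
  deg≥ v v∈∁A = complement-arith {D = degIn G (∁ A) v} (d≤2deg v (∈∁⇒∉ v v∈∁A)) (2*⌊n/2⌋≤n (suc m))

corollary6 : ∀ {n d : ℕ} .{{_ : NonTrivial n}} (G : Graph n) → Regular d G →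
    ∃[ H ] Full {G = G} H × (order H ≡ ⌊ n /2⌋ ⊎ order H ≡ suc ⌊ n /2⌋)
-- `NonTrivial n` excludes 0 and 1. The order of `induced G s` is `∣ s ∣` by definition, so `half`
-- applies unchanged.
corollary6 {2+ m} G regular =
  let s , k , size , deg≥ , half = half-subset G regular
  in  induced G s , induced-full G regular s k size deg≥ , half
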